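{- For every $m$ with $1\le m\le N$ (and every ordering $e_1,\dots,e_N$), the graph $G_m$ has a maximum matching $M$ that intersects every edge of $G^{\mathrm{all}}_m$, i.e. every edge of $G^{\mathrm{all}}_m$ has at least one endpoint covered by $M$.
   Context: Let $n$ be an even integer, $V$ a set of $n$ vertices, $N=\binom n2$. For a graph $G$, $\nu(G)$ is the size of a maximum matching and $\tau(G)$ the minimum cardinality of a vertex cover (a set of vertices incident to every edge). $G$ is a König graph (has property $\mathcal K$) if $\nu(G)=\tau(G)$. The König process: let $e_1,\dots,e_N$ be an ordering of the edges of the complete graph on $V$ (chosen uniformly at random). $G_0$ is the empty graph on $V$. For $0\le m<N$, $G_{m+1}=G_m+e_{m+1}$ if $G_m+e_{m+1}$ is König, and $G_{m+1}=G_m$ otherwise. $G^{\mathrm{all}}_m$ is the graph on $V$ with edge set $\{e_1,\dots,e_m\}$. -}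

module Defs where

open import Data.Bool.Base using (if_then_else_)
open import Data.Fin.Base using (Fin; _<_; fromℕ<)
open import Data.Fin.Properties using (any?) renaming (_≟_ to _≟ᶠ_)
open import Data.Fin.Subset using (Subset; ∣_∣; ⊤) renaming (_∈_ to _∈ˢ_)
open import Data.Fin.Subset.Properties using (_∈?_; ∈⊤; anySubset?)
open import Data.List.Base using (List; []; _∷_; length; filter)
open import Data.List.Membership.Propositional using (_∈_; lose; find)
open import Data.List.Membership.Propositional.Properties using (∈-filter⁺; ∈-filter⁻)
open import Data.List.Properties using (filter-notAll)
open import Data.List.Relation.Unary.All as All using (All; []; _∷_)
open import Data.List.Relation.Unary.AllPairs using (AllPairs; []; _∷_)
open import Data.List.Relation.Unary.Any as Any using (Any)
open import Data.Nat.Base as ℕ using (ℕ; zero; suc; z≤n; s≤s⁻¹)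
open import Data.Nat.Combinatorics using (_C_)
open import Data.Nat.Properties as ℕₚ using (≤∧≢⇒<; ≮⇒≥; <⇒≤; ≤-refl)
open import Data.Product.Base using (∃; _×_; _,_; proj₁; proj₂)
open import Data.Sum.Base using (_⊎_; inj₁)
open import Function.Bundles using (_⤖_; Bijection)
open import Relation.Binary.PropositionalEquality using (_≡_; refl; sym; cong; subst)
open import Relation.Nullary using (¬_; Dec; yes; no)
open import Relation.Nullary.Decidable using (⌊_⌋; ¬?; _×-dec_; _⊎-dec_; map′)

-- An unordered pair of distinct vertices, listed in increasing order so that
-- each edge of the complete graph has exactly one representation.
record Edge (n : ℕ) : Set where
  constructor edge
  field
    fst     : Fin n
    snd     : Fin n
    fst<snd : fst < snd

open Edge public

_IsEndpointOf_ : ∀ {n} → Fin n → Edge n → Set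
v IsEndpointOf e = v ≡ fst e ⊎ v ≡ snd e

Disjoint : ∀ {n} → Edge n → Edge n → Set
Disjoint e f = ¬ ∃ λ v → v IsEndpointOf e × v IsEndpointOf f

-- A graph on the vertex set Fin n, given by its edge set.  Everything below
-- depends only on which edges occur in the list.
Graph : ℕ → Set
Graph n = List (Edge n)

-- Pairwise disjointness excludes repetitions, so length is the cardinality of
-- a matching.
IsMatching : ∀ {n} → Graph n → List (Edge n) → Set
IsMatching G M = All (_∈ G) M × AllPairs Disjoint M

IsMaximumMatching : ∀ {n} → Graph n → List (Edge n) → Set
IsMaximumMatching G M =
  IsMatching G M × (∀ M′ → IsMatching G M′ → length M′ ℕ.≤ length M)

IsVertexCover : ∀ {n} → Graph n → Subset n → Set
IsVertexCover G S = All (λ e → ∃ λ v → v IsEndpointOf e × v ∈ˢ S) G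

IsMinimumVertexCover : ∀ {n} → Graph n → Subset n → Set
IsMinimumVertexCover G S =
  IsVertexCover G S × (∀ S′ → IsVertexCover G S′ → ∣ S ∣ ℕ.≤ ∣ S′ ∣)

Covers : ∀ {n} → List (Edge n) → Fin n → Set
Covers M v = Any (v IsEndpointOf_) M

isEndpointOf? : ∀ {n} (v : Fin n) (e : Edge n) → Dec (v IsEndpointOf e)
isEndpointOf? v e = (v ≟ᶠ fst e) ⊎-dec (v ≟ᶠ snd e)

disjoint? : ∀ {n} (e f : Edge n) → Dec (Disjoint e f)
disjoint? e f = ¬? (any? λ v → isEndpointOf? v e ×-dec isEndpointOf? v f)

private
  remaining : ∀ {n} → Edge n → Graph n → Graph n
  remaining e = filter (disjoint? e)

  matching-∷⁻ : ∀ {n} {G : Graph n} {e M} →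
                IsMatching G (e ∷ M) → IsMatching (remaining e G) M
  matching-∷⁻ {e = e} (_ ∷ M⊆G , e#M ∷ M#) =
    All.zipWith (λ (f∈G , e#f) → ∈-filter⁺ (disjoint? e) f∈G e#f) (M⊆G , e#M) , M#

  matching-∷⁺ : ∀ {n} {G : Graph n} {e M} →
                e ∈ G → IsMatching (remaining e G) M → IsMatching G (e ∷ M)
  matching-∷⁺ {G = G} {e} e∈G (M⊆ , M#) =
    e∈G ∷ All.map (λ f∈ → proj₁ (∈-filter⁻ (disjoint? e) {xs = G} f∈)) M⊆ ,
    All.map (λ f∈ → proj₂ (∈-filter⁻ (disjoint? e) {xs = G} f∈)) M⊆ ∷ M#

  length-matching : ∀ {n} {G : Graph n} M → IsMatching G M → length M ℕ.≤ length G
  length-matching         []      _ = z≤n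
  length-matching {G = G} (e ∷ M) isM@(e∈G ∷ _ , _) =
    ℕₚ.≤-<-trans (length-matching M (matching-∷⁻ isM))
      (filter-notAll (disjoint? e) G
        (lose e∈G λ e#e → e#e (fst e , inj₁ refl , inj₁ refl)))

  matchingOfSize? : ∀ {n} k (G : Graph n) → Dec (∃ λ M → IsMatching G M × length M ≡ k)
  matchingOfSize? zero    G = yes ([] , ([] , []) , refl)
  matchingOfSize? (suc k) G = map′ to from (Any.any? (λ e → matchingOfSize? k (remaining e G)) G)
    where
    to : Any (λ e → ∃ λ M → IsMatching (remaining e G) M × length M ≡ k) G →
         ∃ λ M → IsMatching G M × length M ≡ suc k
    to p with find p
    ... | e , e∈G , M , isM , eq = e ∷ M , matching-∷⁺ e∈G isM , cong suc eq

    from : (∃ λ M → IsMatching G M × length M ≡ suc k) →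
           Any (λ e → ∃ λ M → IsMatching (remaining e G) M × length M ≡ k) G
    from (e ∷ M , isM@(e∈G ∷ _ , _) , refl) = lose e∈G (M , matching-∷⁻ isM , refl)

maximumMatching : ∀ {n} (G : Graph n) → ∃ (IsMaximumMatching G)
maximumMatching G = search (length G) length-matching
  where
  search : ∀ b → (∀ M → IsMatching G M → length M ℕ.≤ b) → ∃ (IsMaximumMatching G)
  search zero    bound = [] , ([] , []) , bound
  search (suc b) bound with matchingOfSize? (suc b) G
  ... | yes (M , isM , eq) =
    M , isM , λ M′ isM′ → subst (length M′ ℕ.≤_) (sym eq) (bound M′ isM′)
  ... | no ∄M = search b λ M isM →
    s≤s⁻¹ (≤∧≢⇒< (bound M isM) λ eq → ∄M (M , isM , eq))

minimumVertexCover : ∀ {n} (G : Graph n) → ∃ (IsMinimumVertexCover G)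
minimumVertexCover {n} G =
  search ∣ ⊤ {n} ∣ ⊤ (All.tabulate λ {e} _ → fst e , inj₁ refl , ∈⊤) ≤-refl
  where
  isVertexCover? : ∀ S → Dec (IsVertexCover G S)
  isVertexCover? S = All.all? (λ e → any? λ v → isEndpointOf? v e ×-dec (v ∈? S)) G

  search : ∀ b S → IsVertexCover G S → ∣ S ∣ ℕ.≤ b → ∃ (IsMinimumVertexCover G)
  search b S isS ∣S∣≤b with anySubset? (λ T → isVertexCover? T ×-dec (∣ T ∣ ℕₚ.<? ∣ S ∣))
  ... | no ∄T = S , isS , λ T isT → ≮⇒≥ λ ∣T∣<∣S∣ → ∄T (T , isT , ∣T∣<∣S∣)
  search zero    S isS ∣S∣≤b | yes (T , isT , ∣T∣<∣S∣)
    with () ← ℕₚ.<-≤-trans ∣T∣<∣S∣ ∣S∣≤b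
  search (suc b) S isS ∣S∣≤b | yes (T , isT , ∣T∣<∣S∣) =
    search b T isT (s≤s⁻¹ (ℕₚ.<-≤-trans ∣T∣<∣S∣ ∣S∣≤b))

ν : ∀ {n} → Graph n → ℕ
ν G = length (proj₁ (maximumMatching G))

τ : ∀ {n} → Graph n → ℕ
τ G = ∣ proj₁ (minimumVertexCover G) ∣

König : ∀ {n} → Graph n → Set
König G = ν G ≡ τ G

könig? : ∀ {n} (G : Graph n) → Dec (König G)
könig? G = ν G ℕₚ.≟ τ G

-- e₁, …, e_N is indexed from 0: the edge e_{m+1} is the image of m.
Ordering : ℕ → Set
Ordering n = Fin (n C 2) ⤖ Edge n

nextEdge : ∀ {n} → Ordering n → ∀ {m} → m ℕ.< n C 2 → Edge n
nextEdge e m<N = Bijection.to e (fromℕ< m<N)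

königProcess : ∀ {n} → Ordering n → ∀ m → m ℕ.≤ n C 2 → Graph n
königProcess e zero    _   = []
königProcess e (suc m) m<N =
  let G  = königProcess e m (<⇒≤ m<N)
      G⁺ = nextEdge e m<N ∷ G
  in  if ⌊ könig? G⁺ ⌋ then G⁺ else G

allEdges : ∀ {n} → Ordering n → ∀ m → m ℕ.≤ n C 2 → Graph n
allEdges e zero    _   = []
allEdges e (suc m) m<N = nextEdge e m<N ∷ allEdges e m (<⇒≤ m<N)

{-# OPTIONS --safe #-}
-- Two facts suffice.  First, any matching M and any larger matching M′ give a
-- matching of size ∣M′∣ covering every vertex that M covers; so, as the process
-- advances, maximum matchings can be chosen with increasing sets of covered
-- vertices.  Second, the process accepts every edge that raises ν, because
-- ν ≤ τ while τ grows by at most one.  Hence a new edge, accepted or not, either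
-- meets the current maximum matching or raises ν; in the second case it is
-- accepted and meets the next maximum matching by maximality.
module Submission where

open import Defs
open import Data.Bool.Base using (if_then_else_)
open import Data.Fin.Base using (Fin)
open import Data.Fin.Properties using (any?; <⇒≢)
open import Data.Fin.Subset using (Subset; inside; outside; ∣_∣; ⊥; ⁅_⁆; _∪_; _-_)
  renaming (_∈_ to _∈ˢ_)
open import Data.Fin.Subset.Properties
  using (∣⊥∣≡0; ∣⁅x⁆∣≡1; x∈⁅x⁆; x∈p∪q⁺; x∈p∧x≢y⇒x∈p-y; x∈p⇒∣p-x∣<∣p∣)
open import Data.List.Base using (List; []; _∷_; length)
open import Data.List.Membership.Propositional using (_∈_; find; lose)
open import Data.List.Membership.Propositional.Properties using (∈-∃++)
open import Data.List.Relation.Binary.Permutation.Propositional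
  using (_↭_; ↭-sym; ↭⇒↭ₛ)
open import Data.List.Relation.Binary.Permutation.Propositional.Properties
  using (shift; All-resp-↭; Any-resp-↭; ↭-length)
import Data.List.Relation.Binary.Permutation.Setoid.Properties as Permₛ
open import Data.List.Relation.Unary.All as All using (All; []; _∷_)
open import Data.List.Relation.Unary.All.Properties using (¬Any⇒All¬)
open import Data.List.Relation.Unary.AllPairs using (AllPairs; []; _∷_)
open import Data.List.Relation.Unary.Any as Any using (Any; here; there)
open import Data.Nat.Base using (ℕ; zero; suc; _+_; _*_; _≤_; _<_; z≤n; s≤s; s≤s⁻¹)
open import Data.Nat.Combinatorics using (_C_)
open import Data.Nat.Divisibility using (_∣_)
open import Data.Nat.Properties
  using (≤-refl; ≤-trans; ≤-reflexive; ≤-antisym; <⇒≤; <⇒≱; ≤∧≢⇒<; _≟_;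
         m≤n⇒m≤1+n; +-suc; *-suc; *-cancelˡ-≤; suc-injective; n<1+n; module ≤-Reasoning)
open import Data.Product.Base using (∃; _×_; _,_; proj₁; proj₂)
open import Data.Sum.Base using (inj₁; inj₂)
open import Data.Vec.Base using ([]; _∷_)
open import Function.Base using (_∘_)
open import Relation.Binary.PropositionalEquality
  using (_≡_; _≢_; refl; sym; trans; cong; subst; resp₂; setoid)
open import Relation.Nullary using (¬_; Dec; yes; no; contradiction)
open import Relation.Nullary.Decidable using (⌊_⌋; ¬?; _×-dec_)

private
  variable
    n : ℕ
    G : Graph n
    M : List (Edge n)
    S : Subset n

-- Auxiliary facts on subsets, permutations and endpoints.

∣p∪q∣≤∣p∣+∣q∣ : ∀ {n} (p q : Subset n) → ∣ p ∪ q ∣ ≤ ∣ p ∣ + ∣ q ∣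
∣p∪q∣≤∣p∣+∣q∣ []            []            = z≤n
∣p∪q∣≤∣p∣+∣q∣ (inside  ∷ p) (inside  ∷ q) = s≤s (≤-trans (∣p∪q∣≤∣p∣+∣q∣ p q)
  (≤-trans (m≤n⇒m≤1+n ≤-refl) (≤-reflexive (sym (+-suc ∣ p ∣ ∣ q ∣)))))
∣p∪q∣≤∣p∣+∣q∣ (inside  ∷ p) (outside ∷ q) = s≤s (∣p∪q∣≤∣p∣+∣q∣ p q)
∣p∪q∣≤∣p∣+∣q∣ (outside ∷ p) (inside  ∷ q) =
  ≤-trans (s≤s (∣p∪q∣≤∣p∣+∣q∣ p q)) (≤-reflexive (sym (+-suc ∣ p ∣ ∣ q ∣)))
∣p∪q∣≤∣p∣+∣q∣ (outside ∷ p) (outside ∷ q) = ∣p∪q∣≤∣p∣+∣q∣ p q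

∣⁅x⁆∪p∣≤1+∣p∣ : ∀ {n} (x : Fin n) (p : Subset n) → ∣ ⁅ x ⁆ ∪ p ∣ ≤ suc ∣ p ∣
∣⁅x⁆∪p∣≤1+∣p∣ x p = ≤-trans (∣p∪q∣≤∣p∣+∣q∣ ⁅ x ⁆ p) (≤-reflexive (cong (_+ ∣ p ∣) (∣⁅x⁆∣≡1 x)))

∈⇒↭∷ : ∀ {A : Set} {x : A} {xs} → x ∈ xs → ∃ λ ys → xs ↭ x ∷ ys
∈⇒↭∷ x∈xs with ∈-∃++ x∈xs
... | ys , zs , refl = _ , shift _ ys zs

Disjoint-sym : ∀ (e f : Edge n) → Disjoint e f → Disjoint f e
Disjoint-sym e f e#f (v , v∈f , v∈e) = e#f (v , v∈e , v∈f)

AllPairs-Disjoint-resp-↭ : {M M′ : List (Edge n)} → M ↭ M′ → AllPairs Disjoint M → AllPairs Disjoint M′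
AllPairs-Disjoint-resp-↭ M↭M′ =
  Permₛ.AllPairs-resp-↭ (setoid _) (λ {e} {f} → Disjoint-sym e f) (resp₂ Disjoint) (↭⇒↭ₛ M↭M′)

-- Once one endpoint `v` of an edge is set aside, only one is left. In `enlarge` this is applied
-- both to `e` and to `f`.
endpoint-unique : ∀ {v x y} (f : Edge n) → v IsEndpointOf f → x IsEndpointOf f → y IsEndpointOf f →
                  x ≢ v → y ≢ v → x ≡ y
endpoint-unique f (inj₁ refl) (inj₁ refl) _           x≢v _   = contradiction refl x≢v
endpoint-unique f (inj₁ refl) _           (inj₁ refl) _   y≢v = contradiction refl y≢v
endpoint-unique f (inj₂ refl) (inj₂ refl) _           x≢v _   = contradiction refl x≢v
endpoint-unique f (inj₂ refl) _           (inj₂ refl) _   y≢v = contradiction refl y≢v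
endpoint-unique f (inj₁ refl) (inj₂ refl) (inj₂ refl) _   _   = refl
endpoint-unique f (inj₂ refl) (inj₁ refl) (inj₁ refl) _   _   = refl

-- Counting the vertices covered by a matching.

covers? : ∀ (M : List (Edge n)) v → Dec (Covers M v)
covers? M v = Any.any? (isEndpointOf? v) M

Meets : List (Edge n) → Edge n → Set
Meets M e = ∃ λ v → v IsEndpointOf e × Covers M v

meets? : ∀ (M : List (Edge n)) e → Dec (Meets M e)
meets? M e = any? λ v → isEndpointOf? v e ×-dec covers? M v

¬Meets⇒Disjoint : ∀ (e : Edge n) → ¬ Meets M e → All (Disjoint e) M
¬Meets⇒Disjoint e ¬m = All.tabulate λ f∈M (v , v∈e , v∈f) → ¬m (v , v∈e , lose f∈M v∈f)

covered : List (Edge n) → Subset n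
covered []      = ⊥
covered (e ∷ M) = ⁅ fst e ⁆ ∪ (⁅ snd e ⁆ ∪ covered M)

∈-covered : ∀ (M : List (Edge n)) {v} → Covers M v → v ∈ˢ covered M
∈-covered (e ∷ M) (here (inj₁ refl)) = x∈p∪q⁺ (inj₁ (x∈⁅x⁆ _))
∈-covered (e ∷ M) (here (inj₂ refl)) = x∈p∪q⁺ {p = ⁅ fst e ⁆} (inj₂ (x∈p∪q⁺ (inj₁ (x∈⁅x⁆ _))))
∈-covered (e ∷ M) (there v∈M) =
  x∈p∪q⁺ {p = ⁅ fst e ⁆} (inj₂ (x∈p∪q⁺ {p = ⁅ snd e ⁆} (inj₂ (∈-covered M v∈M))))

∣covered∣≤2*length : ∀ (M : List (Edge n)) → ∣ covered M ∣ ≤ 2 * length M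
∣covered∣≤2*length {n} [] = ≤-reflexive (∣⊥∣≡0 n)
∣covered∣≤2*length (e ∷ M) = begin
  ∣ ⁅ fst e ⁆ ∪ (⁅ snd e ⁆ ∪ covered M) ∣ ≤⟨ ∣⁅x⁆∪p∣≤1+∣p∣ (fst e) (⁅ snd e ⁆ ∪ covered M) ⟩
  1 + ∣ ⁅ snd e ⁆ ∪ covered M ∣           ≤⟨ s≤s (∣⁅x⁆∪p∣≤1+∣p∣ (snd e) (covered M)) ⟩
  2 + ∣ covered M ∣                       ≤⟨ s≤s (s≤s (∣covered∣≤2*length M)) ⟩
  2 + 2 * length M                        ≡⟨ *-suc 2 (length M) ⟨
  2 * length (e ∷ M)                      ∎
  where open ≤-Reasoning

-- Deleting both endpoints of the first edge, distinct because `fst<snd`, shrinks `S` by two; by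
-- disjointness the other edges still lie inside what is left.
2*length≤∣S∣ : AllPairs Disjoint M → All (λ e → fst e ∈ˢ S × snd e ∈ˢ S) M → 2 * length M ≤ ∣ S ∣
2*length≤∣S∣ [] [] = z≤n
2*length≤∣S∣ {M = e ∷ M} {S = S} (e#M ∷ M#) ((fst∈S , snd∈S) ∷ M⊆S) = begin
  2 * length (e ∷ M)              ≡⟨ *-suc 2 (length M) ⟩
  2 + 2 * length M                ≤⟨ s≤s (s≤s (2*length≤∣S∣ M# (All.zipWith (λ {f} → avoid f) (e#M , M⊆S)))) ⟩
  2 + ∣ S - fst e - snd e ∣       ≤⟨ s≤s (x∈p⇒∣p-x∣<∣p∣ (x∈p∧x≢y⇒x∈p-y snd∈S (<⇒≢ (fst<snd e) ∘ sym))) ⟩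
  1 + ∣ S - fst e ∣               ≤⟨ x∈p⇒∣p-x∣<∣p∣ fst∈S ⟩
  ∣ S ∣                           ∎
  where
  open ≤-Reasoning

  keep : ∀ f {v} → Disjoint e f → v IsEndpointOf f → v ∈ˢ S → v ∈ˢ S - fst e - snd e
  keep f e#f v∈f v∈S = x∈p∧x≢y⇒x∈p-y
    (x∈p∧x≢y⇒x∈p-y v∈S λ v≡ → e#f (_ , inj₁ v≡ , v∈f)) λ v≡ → e#f (_ , inj₂ v≡ , v∈f)

  avoid : ∀ f → Disjoint e f × (fst f ∈ˢ S × snd f ∈ˢ S) →
          fst f ∈ˢ S - fst e - snd e × snd f ∈ˢ S - fst e - snd e
  avoid f (e#f , p , q) = keep f e#f (inj₁ refl) p , keep f e#f (inj₂ refl) q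

-- Enlarging a matching without uncovering vertices.

-- Otherwise the `2 * length M′` distinct endpoints of `M′` would all be among the at most
-- `2 * length M` vertices covered by `M`.
uncovered-endpoint : ∀ {M M′ : List (Edge n)} → AllPairs Disjoint M′ → length M < length M′ →
                     ∃ λ e → e ∈ M′ × ∃ λ u → u IsEndpointOf e × ¬ Covers M u
uncovered-endpoint {M = M} {M′} M′# M<M′
  with Any.any? (λ e → any? λ u → isEndpointOf? u e ×-dec ¬? (covers? M u)) M′
... | yes p = find p
... | no ¬p = contradiction
  (*-cancelˡ-≤ 2 (≤-trans (2*length≤∣S∣ M′# (All.map (λ {e} → inside-M e) (¬Any⇒All¬ M′ ¬p))) (∣covered∣≤2*length M)))
  (<⇒≱ M<M′)
  where
  inside-M : ∀ e → ¬ (∃ λ u → u IsEndpointOf e × ¬ Covers M u) →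
             fst e ∈ˢ covered M × snd e ∈ˢ covered M
  inside-M e ¬u = at (inj₁ refl) , at (inj₂ refl)
    where
    at : ∀ {v} → v IsEndpointOf e → v ∈ˢ covered M
    at {v} v∈e with covers? M v
    ... | yes v∈M = ∈-covered M v∈M
    ... | no  v∉M = contradiction (v , v∈e , v∉M) ¬u

-- Let e = uv be an edge of M′ with u not covered by M.  If M has an edge f at v,
-- apply induction to M − f and M′ − e, all of whose edges avoid u and v.
-- The result covers at most the endpoint w of f other than v: if it does, add e,
-- otherwise add f.
enlarge : ∀ {n} k {P : Edge n → Set} {M M′ : List (Edge n)} →
          All P M × AllPairs Disjoint M → All P M′ × AllPairs Disjoint M′ →
          length M ≤ k → length M′ ≡ k →
          ∃ λ M″ → (All P M″ × AllPairs Disjoint M″) × length M″ ≡ k ×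
                   (∀ {v} → Covers M v → Covers M″ v)
enlarge k {M = M} isM isM′ M≤k M′≡k with length M ≟ k
enlarge k       {M = M} isM isM′ M≤k M′≡k | yes M≡k = M , isM , M≡k , λ c → c
enlarge zero    {M = []} isM isM′ M≤k M′≡k | no M≢k = contradiction refl M≢k
enlarge (suc k) {P} {M} {M′} (PM , M#) (PM′ , M′#) M≤k M′≡k | no M≢k
  with uncovered-endpoint {M = M} M′# (subst (length M <_) (sym M′≡k) (≤∧≢⇒< M≤k M≢k))
... | e , e∈M′ , u , u∈e , u∉M
  with ∈⇒↭∷ e∈M′
... | M′₁ , M′↭
  with All-resp-↭ M′↭ PM′ | AllPairs-Disjoint-resp-↭ M′↭ M′#
... | Pe ∷ PM′₁ | e#M′₁ ∷ M′₁#
  with meets? M e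
... | no ¬meets =
  let M″ , (PM″ , M″#) , M″≡k , M⊆M″ =
        -- Adding disjointness from `e` to the invariant `P` lets `e` be put back on the result.
        enlarge k {λ f → P f × Disjoint e f} (All.zip (PM , ¬Meets⇒Disjoint e ¬meets) , M#)
          (All.zip (PM′₁ , e#M′₁) , M′₁#) (s≤s⁻¹ (≤∧≢⇒< M≤k M≢k))
          (suc-injective (trans (sym (↭-length M′↭)) M′≡k))
  in  e ∷ M″ , (Pe ∷ All.map proj₁ PM″ , All.map proj₂ PM″ ∷ M″#) , cong suc M″≡k ,
      λ c → there (M⊆M″ c)
... | yes (v , v∈e , v∈M)
  with find v∈M
... | f , f∈M , v∈f
  with ∈⇒↭∷ f∈M
... | M₁ , M↭
  with All-resp-↭ M↭ PM | AllPairs-Disjoint-resp-↭ M↭ M#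
... | Pf ∷ PM₁ | f#M₁ ∷ M₁# = conclude
  where
  -- A common vertex of `e` and `g` is not `v`, since `g` is disjoint from `f`; hence it is `u`,
  -- which `M` leaves uncovered.
  e#M₁ : All (Disjoint e) M₁
  e#M₁ = All.tabulate λ {g} g∈M₁ (x , x∈e , x∈g) →
    u∉M (subst (Covers M)
      (endpoint-unique e v∈e x∈e u∈e
        (λ { refl → All.lookup f#M₁ g∈M₁ (x , v∈f , x∈g) })
        (λ { refl → u∉M v∈M }))
      (Any-resp-↭ (↭-sym M↭) (there (lose g∈M₁ x∈g))))

  conclude : ∃ λ M″ → (All P M″ × AllPairs Disjoint M″) × length M″ ≡ suc k ×
                      (∀ {v} → Covers M v → Covers M″ v)
  conclude
    with enlarge k {λ g → P g × Disjoint e g} (All.zip (PM₁ , e#M₁) , M₁#)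
           (All.zip (PM′₁ , e#M′₁) , M′₁#)
           (s≤s⁻¹ (subst (_≤ suc k) (↭-length M↭) M≤k))
           (suc-injective (trans (sym (↭-length M′↭)) M′≡k))
  ... | M″ , (PM″ , M″#) , M″≡k , M₁⊆M″
    with meets? M″ f
  ... | no ¬meets =
    f ∷ M″ , (Pf ∷ All.map proj₁ PM″ , ¬Meets⇒Disjoint f ¬meets ∷ M″#) , cong suc M″≡k , widen
    where
    widen : ∀ {y} → Covers M y → Covers (f ∷ M″) y
    widen c with Any-resp-↭ M↭ c
    ... | here y∈f   = here y∈f
    ... | there y∈M₁ = there (M₁⊆M″ y∈M₁)
  ... | yes (w , w∈f , w∈M″) =
    e ∷ M″ , (Pe ∷ All.map proj₁ PM″ , All.map proj₂ PM″ ∷ M″#) , cong suc M″≡k , widen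
    where
    -- `v` lies on `e`, and all edges of `M″` are disjoint from `e`.
    w≢v : w ≢ v
    w≢v refl with find w∈M″
    ... | g , g∈M″ , w∈g = proj₂ (All.lookup PM″ g∈M″) (w , v∈e , w∈g)

    widen : ∀ {y} → Covers M y → Covers (e ∷ M″) y
    widen {y} c with Any-resp-↭ M↭ c
    ... | there y∈M₁ = there (M₁⊆M″ y∈M₁)
    -- An endpoint of `f` off `e` differs from `v`, so it is `w`, already covered by `M″`.
    ... | here y∈f with isEndpointOf? y e
    ...   | yes y∈e = here y∈e
    ...   | no  y∉e = there (subst (Covers M″)
      (endpoint-unique f v∈f w∈f y∈f w≢v λ { refl → y∉e v∈e }) w∈M″)

-- Apply `enlarge` against a maximum matching of `G`, with membership in `G` as the invariant `P`.
maximumMatching-⊇ : IsMatching G M → ∃ λ M″ → IsMaximumMatching G M″ × (∀ {v} → Covers M v → Covers M″ v)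
maximumMatching-⊇ {G = G} {M = M} isM =
  let M′ , isM′ , max       = maximumMatching G
      M″ , isM″ , eq , M⊆M″ = enlarge (length M′) isM isM′ (max M isM) refl
  in  M″ , (isM″ , λ M₀ isM₀ → subst (length M₀ ≤_) (sym eq) (max M₀ isM₀)) , M⊆M″

-- Matching number, cover number and the König property.

length≤ν : IsMatching G M → length M ≤ ν G
length≤ν {G = G} {M = M} = proj₂ (proj₂ (maximumMatching G)) M

τ≤∣cover∣ : ∀ (G : Graph n) S → IsVertexCover G S → τ G ≤ ∣ S ∣
τ≤∣cover∣ G S = proj₂ (proj₂ (minimumVertexCover G)) S

-- A cover vertex on the first edge lies on no later edge, so deleting it leaves a cover of the
-- rest.
length≤∣cover∣ : AllPairs Disjoint M → IsVertexCover M S → length M ≤ ∣ S ∣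
length≤∣cover∣ [] [] = z≤n
length≤∣cover∣ {M = e ∷ _} {S = S} (e#M ∷ M#) ((v , v∈e , v∈S) ∷ cover) =
  ≤-trans (s≤s (length≤∣cover∣ M# (All.zipWith (λ {f} → avoid f) (e#M , cover)))) (x∈p⇒∣p-x∣<∣p∣ v∈S)
  where
  avoid : ∀ f → Disjoint e f × (∃ λ x → x IsEndpointOf f × x ∈ˢ S) →
          ∃ λ x → x IsEndpointOf f × x ∈ˢ S - v
  avoid f (e#f , x , x∈f , x∈S) =
    x , x∈f , x∈p∧x≢y⇒x∈p-y x∈S λ { refl → e#f (x , v∈e , x∈f) }

ν≤τ : ∀ (G : Graph n) → ν G ≤ τ G
ν≤τ G =
  let M , (M⊆G , M#) , _ = maximumMatching G
      S , cover , _      = minimumVertexCover G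
  in  length≤∣cover∣ {M = M} {S = S} M# (All.map (All.lookup cover) M⊆G)

τ-∷≤ : ∀ (e : Edge n) G → τ (e ∷ G) ≤ suc (τ G)
τ-∷≤ e G =
  let S , cover , _ = minimumVertexCover G
  in  ≤-trans
        (τ≤∣cover∣ (e ∷ G) (⁅ fst e ⁆ ∪ S)
          ((fst e , inj₁ refl , x∈p∪q⁺ (inj₁ (x∈⁅x⁆ _))) ∷
           All.map (λ (v , v∈f , v∈S) → v , v∈f , x∈p∪q⁺ {p = ⁅ fst e ⁆} (inj₂ v∈S)) cover))
        (∣⁅x⁆∪p∣≤1+∣p∣ (fst e) S)

könig-[] : ∀ n → König {n} []
könig-[] n = ≤-antisym (ν≤τ {n} []) (begin
  τ {n} []  ≤⟨ τ≤∣cover∣ {n} [] ⊥ [] ⟩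
  ∣ ⊥ {n} ∣ ≡⟨ ∣⊥∣≡0 n ⟩
  0         ≤⟨ z≤n ⟩
  ν {n} []  ∎)
  where open ≤-Reasoning

-- `τ (e ∷ G)` is at most `suc (τ G)`, which equals `suc (ν G)` and so is at most `ν (e ∷ G)`; the
-- other inequality is `ν≤τ`.
könig-∷ : ∀ (e : Edge n) G → König G → ν G < ν (e ∷ G) → König (e ∷ G)
könig-∷ e G kG ν< = ≤-antisym (ν≤τ (e ∷ G))
  (≤-trans (τ-∷≤ e G) (subst (λ t → suc t ≤ ν (e ∷ G)) kG ν<))

-- A `with` on könig? would normalise the searches computing ν and τ.
if-Dec : ∀ {A P : Set} (Q : A → Set) (d : Dec P) {x y} →
         (P → Q x) → (¬ P → Q y) → Q (if ⌊ d ⌋ then x else y)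
if-Dec Q (yes p) qx qy = qx p
if-Dec Q (no ¬p) qx qy = qy ¬p

-- Edges met by maximum matchings along the process.

könig-process : ∀ (e : Ordering n) m (m≤N : m ≤ n C 2) → König (königProcess e m m≤N)
könig-process {n} e zero _ = könig-[] n
könig-process e (suc m) m<N =
  if-Dec König (könig? (nextEdge e m<N ∷ königProcess e m (<⇒≤ m<N)))
    (λ k → k) (λ _ → könig-process e m (<⇒≤ m<N))

weaken-matching : ∀ {e : Edge n} → IsMatching G M → IsMatching (e ∷ G) M
weaken-matching (M⊆G , M#) = All.map there M⊆G , M#

extend-matching : ∀ {e : Edge n} → e ∈ G → IsMatching G M → ¬ Meets M e → IsMatching G (e ∷ M)
extend-matching {e = e} e∈G (M⊆G , M#) ¬meets = e∈G ∷ M⊆G , ¬Meets⇒Disjoint e ¬meets ∷ M#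

maximum-meets : ∀ {e : Edge n} → IsMaximumMatching G M → e ∈ G → Meets M e
maximum-meets {M = M} {e} (isM , max) e∈G with meets? M e
... | yes p = p
... | no ¬p = contradiction (max (e ∷ M) (extend-matching e∈G isM ¬p)) (<⇒≱ (n<1+n _))

-- If `M` missed `e`, adding `e` to `M` would show that `e` raises `ν`, and `könig-∷` would make
-- `e ∷ G` König.
rejected-meets : ∀ {e : Edge n} → König G → IsMaximumMatching G M → ¬ König (e ∷ G) → Meets M e
rejected-meets {G = G} {M = M} {e} kG (isM , max) ¬k with meets? M e
... | yes p = p
... | no ¬p = contradiction (könig-∷ e G kG ν<) ¬k
  where
  ν< : ν G < ν (e ∷ G)
  -- `ν G` is the length of one particular maximum matching, so maximality of `M` bounds it by the
  -- length of `M`.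
  ν< = ≤-trans (s≤s (max _ (proj₁ (proj₂ (maximumMatching G)))))
               (length≤ν (extend-matching (here refl) (weaken-matching isM) ¬p))

maximumMatching-meeting-allEdges : ∀ (e : Ordering n) m (m≤N : m ≤ n C 2) →
  ∃ λ M → IsMaximumMatching (königProcess e m m≤N) M × (∀ f → f ∈ allEdges e m m≤N → Meets M f)
maximumMatching-meeting-allEdges e zero    _ =
  let M , isMax = maximumMatching [] in M , isMax , λ _ ()
maximumMatching-meeting-allEdges e (suc m) m<N =
  let M , isMax , meets = maximumMatching-meeting-allEdges e m (<⇒≤ m<N)
      -- `M` remains a matching once the new edge is added, and growing it keeps every earlier edge
      -- met. This `M″` serves only when the edge is accepted; after a rejection `M` itself is kept.
      M″ , isMax″ , M⊆M″ = maximumMatching-⊇ (weaken-matching (proj₁ isMax))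
  in  if-Dec
        (λ G → ∃ λ M → IsMaximumMatching G M × (∀ f → f ∈ allEdges e (suc m) m<N → Meets M f))
        (könig? (nextEdge e m<N ∷ königProcess e m (<⇒≤ m<N)))
        (λ _ → M″ , isMax″ , λ where
          _ (here refl) → maximum-meets isMax″ (here refl)
          f (there f∈)  → let v , v∈f , v∈M = meets f f∈ in v , v∈f , M⊆M″ v∈M)
        (λ ¬k → M , isMax , λ where
          _ (here refl) → rejected-meets (könig-process e m (<⇒≤ m<N)) isMax ¬k
          f (there f∈)  → meets f f∈)

proposition1p1 : ∀ (n : ℕ) → 2 ∣ n → (e : Ordering n) →
    ∀ (m : ℕ) → 1 ≤ m → (m≤N : m ≤ n C 2) →
    ∃ λ (M : List (Edge n)) →
    IsMaximumMatching (königProcess e m m≤N) M ×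
    (∀ (f : Edge n) → f ∈ allEdges e m m≤N →
    ∃ λ v → v IsEndpointOf f × Covers M v)
proposition1p1 n _ e m _ m≤N = maximumMatching-meeting-allEdges e m m≤N
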